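{- Let $s,t \ge 2$ be integers. The class of $\{(s,t)\text{ -bowtie}, P_5, (s+1,t+1)\text{ -dumbbell}\}$-free graphs is $(2t-2)$-strongly Pollyanna.
   Context: All graphs are finite, simple and undirected; "$H$-free" means having no induced subgraph isomorphic to $H$, and $\mathcal{H}$-free means $H$-free for every $H\in\mathcal{H}$. $P_5$ is the path on $5$ vertices. $\chi(G)$ is the chromatic number and $\omega(G)$ the clique number. An $(s,t)$-bowtie is obtained from the disjoint union of $K_s$ and $K_t$ by adding a new vertex adjacent to all other vertices. An $(a,b)$-dumbbell is obtained from the disjoint union of $K_a$ and $K_b$ by adding a single edge between a vertex of $K_a$ and a vertex of $K_b$. For an integer $n$, $\chi^{(n)}(G)$ denotes the maximum chromatic number of an induced subgraph $H$ of $G$ with $\omega(H)\le n$. A class $\mathcal{F}$ is $n$-good if it is hereditary and there is a constant $m$ with $\chi^{(n)}(G)\le m$ for all $G\in\mathcal{F}$. A hereditary class is polynomially $\chi$-bounded if there is a polynomial $f$ with $\chi(G)\le f(\omega(G))$ for every $G$ in the class. A class $\mathcal{C}$ is $n$-strongly Pollyanna if for every $n$-good class $\mathcal{F}$, the class $\mathcal{C}\cap\mathcal{F}$ is polynomially $\chi$-bounded. -}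

module Defs where

open import Data.Nat using (ℕ; zero; suc; _+_; _*_; _<ᵇ_; _≡ᵇ_)
open import Data.Fin using (Fin; toℕ) renaming (zero to fzero; suc to fsuc)
open import Data.Bool using (Bool; true; false; _∨_; _∧_; not; T; if_then_else_)
open import Data.List using (List; []; _∷_)
open import Data.Product using (Σ; _×_; _,_)
open import Relation.Nullary using (¬_)
open import Relation.Binary.PropositionalEquality using (_≡_; _≢_)
open import Function.Bundles using (_⇔_)
open import Function.Definitions using (Injective)

-- A finite simple graph on vertex set Fin size. The raw Boolean table is
-- symmetrised and loops are discarded, so Adj is always a simple graph.
record Graph : Set where
  field
    size : ℕ
    edge : Fin size → Fin size → Bool

open Graph public

Adj : (G : Graph) → Fin (size G) → Fin (size G) → Set
Adj G u v = (u ≢ v) × T (edge G u v ∨ edge G v u)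

_↪_ : Graph → Graph → Set
H ↪ G = Σ (Fin (size H) → Fin (size G)) λ f →
          Injective _≡_ _≡_ f × (∀ u v → Adj H u v ⇔ Adj G (f u) (f v))

Free : Graph → Graph → Set
Free H G = ¬ (H ↪ G)

Colourable : Graph → ℕ → Set
Colourable G k = Σ (Fin (size G) → Fin k) λ c →
                   ∀ u v → Adj G u v → c u ≢ c v

HasClique : Graph → ℕ → Set
HasClique G k = Σ (Fin k → Fin (size G)) λ f →
                  Injective _≡_ _≡_ f × (∀ i j → i ≢ j → Adj G (f i) (f j))

CliqueAtMost : Graph → ℕ → Set
CliqueAtMost G n = ¬ HasClique G (suc n)

CliqueNumber : Graph → ℕ → Set
CliqueNumber G w = HasClique G w × CliqueAtMost G w

Class : Set₁
Class = Graph → Set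

Hereditary : Class → Set
Hereditary C = ∀ G H → C G → H ↪ G → C H

Good : ℕ → Class → Set
Good n F = Hereditary F ×
  Σ ℕ λ m → ∀ G → F G → ∀ H → H ↪ G → CliqueAtMost H n → Colourable H m

evalPoly : List ℕ → ℕ → ℕ
evalPoly [] x = 0
evalPoly (a ∷ as) x = a + x * evalPoly as x

PolyChiBounded : Class → Set
PolyChiBounded C = Σ (List ℕ) λ p →
  ∀ G → C G → ∀ w → CliqueNumber G w → Colourable G (evalPoly p w)

StronglyPollyanna : ℕ → Class → Set₁
StronglyPollyanna n C = ∀ (F : Class) → Good n F → PolyChiBounded (λ G → C G × F G)

neqᵇ : ∀ {k} → Fin k → Fin k → Bool
neqᵇ i j = not (toℕ i ≡ᵇ toℕ j)

P5 : Graph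
P5 = record { size = 5 ; edge = λ i j → suc (toℕ i) ≡ᵇ toℕ j }

-- (s,t)-bowtie: vertex 0 is the centre; vertices 1..s form K_s, s+1..s+t form K_t
bowtie : ℕ → ℕ → Graph
bowtie s t = record { size = suc (s + t) ; edge = e }
  where
    e : Fin (suc (s + t)) → Fin (suc (s + t)) → Bool
    e fzero (fsuc j) = true
    e fzero fzero = false
    e (fsuc i) fzero = true
    e (fsuc i) (fsuc j) = neqᵇ i j ∧ ((toℕ i <ᵇ s) ≡ᵇᵇ (toℕ j <ᵇ s))
      where
        _≡ᵇᵇ_ : Bool → Bool → Bool
        true ≡ᵇᵇ b = b
        false ≡ᵇᵇ b = not b

-- (a,b)-dumbbell: vertices 0..a-1 form K_a, a..a+b-1 form K_b, plus edge {0, a}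
dumbbell : ℕ → ℕ → Graph
dumbbell a b = record { size = a + b ; edge = e }
  where
    same : Bool → Bool → Bool
    same true b' = b'
    same false b' = not b'
    e : Fin (a + b) → Fin (a + b) → Bool
    e i j = (neqᵇ i j ∧ same (toℕ i <ᵇ a) (toℕ j <ᵇ a))
            ∨ ((toℕ i ≡ᵇ 0) ∧ (toℕ j ≡ᵇ a))

{-# OPTIONS --safe #-}
-- Gyárfás: if every neighbourhood of a P₅-free graph is p-colourable, then the graph is
-- (3p+1)-colourable. Indeed, in a connected graph fix v, a component C of the graph without
-- v and N(v), and u ∈ N(v) with a neighbour in C. Any component D of C \ N(u) meets N(c) for
-- some c ∈ C ∩ N(u), and then D ⊆ N(c), since an edge d d' of D leaving N(c) would
-- give the induced path v u c d d'. So D, C ∩ N(u) and N(v) are all p-colourable.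
--
-- In particular, P₅-free graphs of bounded clique number have bounded chromatic number, and it
-- remains to colour neighbourhoods, which contain no disjoint anticomplete Kₛ and Kₜ.
-- Walk through a maximum clique K, at each vertex v of K splitting the current set into
-- neighbours and non-neighbours of v. A part that collected s non-neighbours is Kₜ-free,
-- and one that collected fewer has clique number at most s by maximality of K. There
-- are polynomially many parts.
module Submission where

open import Defs
open import Data.Bool using (true; false; T; _∨_)
open import Data.Bool.Properties using (T?; ∨-comm; ∧-zeroʳ)
open import Data.Empty using (⊥; ⊥-elim)
open import Data.Fin using (Fin; toℕ; fromℕ<; splitAt; join; _↑ˡ_; _↑ʳ_) renaming (zero to fzero; suc to fsuc; _≟_ to _≟F_)
open import Data.Fin.Patterns using (0F; 1F; 2F; 3F; 4F)
open import Data.Fin.Properties using (any?; all?; toℕ-injective; toℕ<n; toℕ-↑ˡ; toℕ-↑ʳ; ↑ˡ-injective; ↑ʳ-injective; splitAt⁻¹-↑ˡ; splitAt⁻¹-↑ʳ; join-splitAt; suc-injective; fromℕ<-injective)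
open import Data.Fin.Subset using (Subset; _∈_; _∉_; _⊆_; _∩_; ∁; ⁅_⁆; Nonempty; ∣_∣) renaming (⊤ to Full)
open import Data.Fin.Subset.Properties using (_∈?_; _⊂?_; nonempty?; anySubset?; x∈p∩q⁺; p∩q⊆p; p∩q⊆q; x∈∁p⇒x∉p; x∉p⇒x∈∁p; x∈⁅x⁆; x∈⁅y⁆⇒x≡y; x≢y⇒x∉⁅y⁆; p⊂q⇒∣p∣<∣q∣; ∈⊤; ⊆-refl)
open import Data.List using (List; []; _∷_)
open import Data.Nat using (ℕ; zero; suc; _+_; _*_; _∸_; _^_; _≤_; _<_; z≤n; s≤s; _<ᵇ_; _≡ᵇ_)
open import Data.Nat.Induction using (<-wellFounded)
open import Data.Nat.Properties using (<-cmp; ≤-trans; ≤-refl; ≤-reflexive; m≤m+n; m≤n+m; <-≤-trans; <⇒≱; +-monoʳ-<; *-monoʳ-≤; ^-monoˡ-≤; n≤1+n; m≤n⇒m≤1+n; +-suc; +-comm; +-identityʳ; *-identityʳ; *-distribˡ-+; ^-zeroˡ; <⇒<ᵇ; <ᵇ⇒<; ≡ᵇ⇒≡; +-cancelˡ-≡; module ≤-Reasoning)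
open import Data.Nat.Tactic.RingSolver using (solve-∀)
open import Data.Product using (Σ; _×_; _,_; proj₁; proj₂)
open import Data.Sum using (_⊎_; inj₁; inj₂; [_,_]′)
open import Data.Unit using (tt) renaming (⊤ to Unit)
open import Data.Vec using (tabulate)
open import Data.Vec.Properties using ([]=⇒lookup; lookup⇒[]=; lookup∘tabulate)
open import Function using (_∘_)
open import Function.Properties.Equivalence using () renaming (trans to ⇔-trans)
open import Function.Bundles using (_⇔_; mk⇔; Equivalence)
open import Induction.WellFounded using (Acc; acc)
open import Relation.Binary using (tri<; tri≈; tri>)
open import Relation.Binary.PropositionalEquality using (_≡_; _≢_; refl; sym; trans; cong; subst; ≢-sym)
open import Relation.Nullary using (¬_; Dec; yes; no; does; contradiction)
open import Relation.Nullary.Decidable using (_×-dec_; _→-dec_; ¬?; dec-true)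

-- Decidable adjacency and induced embeddings.

does-true : ∀ {P : Set} (P? : Dec P) → does P? ≡ true → P
does-true (yes p) _ = p

Adj? : ∀ G u v → Dec (Adj G u v)
Adj? G u v = ¬? (u ≟F v) ×-dec T? _

Adj-sym : ∀ G {u v} → Adj G u v → Adj G v u
Adj-sym G {u} {v} (u≢v , e) = ≢-sym u≢v , subst T (∨-comm (edge G u v) (edge G v u)) e

-- Distinctness and adjacency are symmetric, so ordered pairs suffice; for `P5` this leaves ten
-- cases.
↪-from-< : ∀ H G (f : Fin (size H) → Fin (size G)) →
           (∀ i j → toℕ i < toℕ j → f i ≢ f j × (Adj H i j ⇔ Adj G (f i) (f j))) → H ↪ G
↪-from-< H G f ordered = f , injective , adj
  where
  injective : ∀ {i j} → f i ≡ f j → i ≡ j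
  injective {i} {j} eq with <-cmp (toℕ i) (toℕ j)
  ... | tri< i<j _ _ = contradiction eq (proj₁ (ordered i j i<j))
  ... | tri≈ _ i≡j _ = toℕ-injective i≡j
  ... | tri> _ _ j<i = contradiction (sym eq) (proj₁ (ordered j i j<i))
  adj : ∀ i j → Adj H i j ⇔ Adj G (f i) (f j)
  adj i j with <-cmp (toℕ i) (toℕ j)
  ... | tri< i<j _ _ = proj₂ (ordered i j i<j)
  ... | tri≈ _ i≡j _ = mk⇔ (λ a → contradiction (toℕ-injective i≡j) (proj₁ a))
                           (λ a → contradiction (cong f (toℕ-injective i≡j)) (proj₁ a))
  ... | tri> _ _ j<i = mk⇔ (Adj-sym G ∘ Equivalence.to ji ∘ Adj-sym H)
                           (Adj-sym H ∘ Equivalence.from ji ∘ Adj-sym G)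
    where ji = proj₂ (ordered j i j<i)

-- Vertices of the bowtie

SameSide : ∀ {s t} → Fin s ⊎ Fin t → Fin s ⊎ Fin t → Set
SameSide (inj₁ a) (inj₁ b) = a ≢ b
SameSide (inj₂ a) (inj₂ b) = a ≢ b
SameSide _ _ = ⊥

T-neqᵇ : ∀ {k} {i j : Fin k} → i ≢ j → T (neqᵇ i j)
T-neqᵇ {i = i} {j} i≢j with toℕ i ≡ᵇ toℕ j in eq
... | false = tt
... | true = i≢j (toℕ-injective (≡ᵇ⇒≡ _ _ (subst T (sym eq) tt)))

↑ˡ-<ᵇ : ∀ {s} (a : Fin s) t → (toℕ (a ↑ˡ t) <ᵇ s) ≡ true
↑ˡ-<ᵇ {s} a t = T⇒≡ (<⇒<ᵇ (subst (_< s) (sym (toℕ-↑ˡ a t)) (toℕ<n a)))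
  where
  T⇒≡ : ∀ {b} → T b → b ≡ true
  T⇒≡ {true} _ = refl

↑ʳ-<ᵇ : ∀ s {t} (b : Fin t) → (toℕ (s ↑ʳ b) <ᵇ s) ≡ false
↑ʳ-<ᵇ s b with toℕ (s ↑ʳ b) <ᵇ s in eq
... | false = refl
... | true = contradiction (≤-trans (m≤m+n s (toℕ b)) (≤-reflexive (sym (toℕ-↑ʳ s b))))
                           (<⇒≱ (<ᵇ⇒< _ _ (subst T (sym eq) tt)))

module _ {s t : ℕ} where

  -- `splitAt s` and the test `<ᵇ s` select the same side, so the Boolean table can be replaced by a
  -- case split on constructors.
  bowtie-adj : ∀ i j → Adj (bowtie s t) (fsuc i) (fsuc j) ⇔ SameSide {s} {t} (splitAt s i) (splitAt s j)
  bowtie-adj i j with splitAt s i in eqi | splitAt s j in eqj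
  ... | inj₁ a | inj₁ b with refl ← splitAt⁻¹-↑ˡ {m = s} {i = i} eqi | refl ← splitAt⁻¹-↑ˡ {m = s} {i = j} eqj
    = mk⇔ (λ (i≢j , _) a≡b → i≢j (cong (λ c → fsuc (c ↑ˡ t)) a≡b))
          (λ a≢b → let i≢j = a≢b ∘ ↑ˡ-injective t a b in i≢j ∘ suc-injective , joined i≢j)
    where
    joined : a ↑ˡ t ≢ b ↑ˡ t → T (edge (bowtie s t) (fsuc (a ↑ˡ t)) (fsuc (b ↑ˡ t)) ∨ edge (bowtie s t) (fsuc (b ↑ˡ t)) (fsuc (a ↑ˡ t)))
    joined i≢j rewrite ↑ˡ-<ᵇ a t | ↑ˡ-<ᵇ b t with neqᵇ (a ↑ˡ t) (b ↑ˡ t) | T-neqᵇ i≢j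
    ... | true | _ = tt
  ... | inj₂ a | inj₂ b with refl ← splitAt⁻¹-↑ʳ {m = s} {i = i} eqi | refl ← splitAt⁻¹-↑ʳ {m = s} {i = j} eqj
    = mk⇔ (λ (i≢j , _) a≡b → i≢j (cong (λ c → fsuc (s ↑ʳ c)) a≡b))
          (λ a≢b → let i≢j = a≢b ∘ ↑ʳ-injective s a b in i≢j ∘ suc-injective , joined i≢j)
    where
    joined : s ↑ʳ a ≢ s ↑ʳ b → T (edge (bowtie s t) (fsuc (s ↑ʳ a)) (fsuc (s ↑ʳ b)) ∨ edge (bowtie s t) (fsuc (s ↑ʳ b)) (fsuc (s ↑ʳ a)))
    joined i≢j rewrite ↑ʳ-<ᵇ s a | ↑ʳ-<ᵇ s b with neqᵇ (s ↑ʳ a) (s ↑ʳ b) | T-neqᵇ i≢j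
    ... | true | _ = tt
  bowtie-adj i j | inj₁ a | inj₂ b with refl ← splitAt⁻¹-↑ˡ {m = s} {i = i} eqi | refl ← splitAt⁻¹-↑ʳ {m = s} {i = j} eqj
    = mk⇔ (λ (_ , e) → separated e) ⊥-elim
    where
    separated : ¬ T (edge (bowtie s t) (fsuc (a ↑ˡ t)) (fsuc (s ↑ʳ b)) ∨ edge (bowtie s t) (fsuc (s ↑ʳ b)) (fsuc (a ↑ˡ t)))
    separated rewrite ↑ˡ-<ᵇ a t | ↑ʳ-<ᵇ s b | ∧-zeroʳ (neqᵇ (a ↑ˡ t) (s ↑ʳ b)) | ∧-zeroʳ (neqᵇ (s ↑ʳ b) (a ↑ˡ t)) = λ ()
  bowtie-adj i j | inj₂ a | inj₁ b with refl ← splitAt⁻¹-↑ʳ {m = s} {i = i} eqi | refl ← splitAt⁻¹-↑ˡ {m = s} {i = j} eqj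
    = mk⇔ (λ (_ , e) → separated e) ⊥-elim
    where
    separated : ¬ T (edge (bowtie s t) (fsuc (s ↑ʳ a)) (fsuc (b ↑ˡ t)) ∨ edge (bowtie s t) (fsuc (b ↑ˡ t)) (fsuc (s ↑ʳ a)))
    separated rewrite ↑ˡ-<ᵇ b t | ↑ʳ-<ᵇ s a | ∧-zeroʳ (neqᵇ (b ↑ˡ t) (s ↑ʳ a)) | ∧-zeroʳ (neqᵇ (s ↑ʳ a) (b ↑ˡ t)) = λ ()

-- The recursion from p to 3p+1, solved by (3^k - 1)/2, with the summands in the order in which
-- `colour-from-neighbourhoods` produces them.
gyarfasBound : ℕ → ℕ
gyarfasBound zero = 0
gyarfasBound (suc k) = gyarfasBound k + suc (gyarfasBound k + gyarfasBound k)

gyarfasBound-mono : ∀ i r → gyarfasBound r ≤ gyarfasBound (i + r)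
gyarfasBound-mono zero r = ≤-refl
gyarfasBound-mono (suc i) r = ≤-trans (gyarfasBound-mono i r) (m≤m+n _ _)

-- Neighbourhoods as vertex subsets.

module _ (G : Graph) where

  V : Set
  V = Fin (size G)

  N : V → Subset (size G)
  N v = tabulate (λ u → does (Adj? G v u))

  ∈N⁺ : ∀ {v u} → Adj G v u → u ∈ N v
  ∈N⁺ {v} {u} a = lookup⇒[]= u (N v) (trans (lookup∘tabulate _ u) (dec-true (Adj? G v u) a))

  ∈N⁻ : ∀ {v u} → u ∈ N v → Adj G v u
  ∈N⁻ {v} {u} u∈ = does-true (Adj? G v u) (trans (sym (lookup∘tabulate _ u)) ([]=⇒lookup u∈))

  ∩-mono : ∀ {X Y} (Z : Subset (size G)) → X ⊆ Y → X ∩ Z ⊆ Y ∩ Z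
  ∩-mono {X} Z X⊆Y x∈ = x∈p∩q⁺ (X⊆Y (p∩q⊆p X Z x∈) , p∩q⊆q X Z x∈)

  ∈∖⁺ : ∀ {X Y : Subset (size G)} {x} → x ∈ X → x ∉ Y → x ∈ X ∩ ∁ Y
  ∈∖⁺ x∈X x∉Y = x∈p∩q⁺ (x∈X , x∉p⇒x∈∁p x∉Y)

  ∈∖⁻ : ∀ {X Y : Subset (size G)} {x} → x ∈ X ∩ ∁ Y → x ∉ Y
  ∈∖⁻ {X} {Y} x∈ = x∈∁p⇒x∉p (p∩q⊆q X (∁ Y) x∈)

  -- Colourings of vertex sets

  -- Colours are total and natural-valued, arbitrary outside `X`, so sets can be split and rejoined
  -- without forming induced subgraphs.
  ColourableOn : Subset (size G) → ℕ → Set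
  ColourableOn X k = Σ (V → ℕ) λ c →
    (∀ {u} → u ∈ X → c u < k) × (∀ {u v} → u ∈ X → v ∈ X → Adj G u v → c u ≢ c v)

  colour-mono : ∀ {X Y k l} → X ⊆ Y → k ≤ l → ColourableOn Y k → ColourableOn X l
  colour-mono X⊆Y k≤l (c , bound , proper) =
    c , (λ u∈ → <-≤-trans (bound (X⊆Y u∈)) k≤l) , λ u∈ v∈ → proper (X⊆Y u∈) (X⊆Y v∈)

  colour-singleton : ∀ v → ColourableOn ⁅ v ⁆ 1
  colour-singleton v = (λ _ → 0) , (λ _ → s≤s z≤n) ,
    λ u∈ w∈ a → contradiction (trans (x∈⁅y⁆⇒x≡y v u∈) (sym (x∈⁅y⁆⇒x≡y v w∈))) (proj₁ a)

  -- Edges may run between the parts, so the second palette is shifted by `a`.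
  colour-split : ∀ {X} A {a b} → ColourableOn (X ∩ A) a → ColourableOn (X ∩ ∁ A) b → ColourableOn X (a + b)
  colour-split {X} A {a} {b} (c , c< , c-proper) (d , d< , d-proper) = e , bound , proper
    where
    e : V → ℕ
    e u with u ∈? A
    ... | yes _ = c u
    ... | no _ = a + d u
    bound : ∀ {u} → u ∈ X → e u < a + b
    bound {u} u∈X with u ∈? A
    ... | yes u∈A = <-≤-trans (c< (x∈p∩q⁺ (u∈X , u∈A))) (m≤m+n a b)
    ... | no u∉A = +-monoʳ-< a (d< (∈∖⁺ u∈X u∉A))
    proper : ∀ {u v} → u ∈ X → v ∈ X → Adj G u v → e u ≢ e v
    proper {u} {v} u∈X v∈X a~ with u ∈? A | v ∈? A
    ... | yes u∈A | yes v∈A = c-proper (x∈p∩q⁺ (u∈X , u∈A)) (x∈p∩q⁺ (v∈X , v∈A)) a~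
    ... | yes u∈A | no _ = λ eq → <⇒≱ (c< (x∈p∩q⁺ (u∈X , u∈A))) (≤-trans (m≤m+n a _) (≤-reflexive (sym eq)))
    ... | no _ | yes v∈A = λ eq → <⇒≱ (c< (x∈p∩q⁺ (v∈X , v∈A))) (≤-trans (m≤m+n a _) (≤-reflexive eq))
    ... | no u∉A | no v∉A = d-proper (∈∖⁺ u∈X u∉A) (∈∖⁺ v∈X v∉A) a~ ∘ +-cancelˡ-≡ a _ _

  Closed : Subset (size G) → Subset (size G) → Set
  Closed D X = ∀ u v → u ∈ D → v ∈ X → Adj G u v → v ∈ D

  closed? : ∀ D X → Dec (Closed D X)
  closed? D X = all? λ u → all? λ v → u ∈? D →-dec (v ∈? X →-dec (Adj? G u v →-dec v ∈? D))

  -- Connectedness without paths: each application exhibits a nonempty closed subset and concludes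
  -- that it is everything.
  Connected : Subset (size G) → Set
  Connected X = ∀ D → D ⊆ X → Nonempty D → Closed D X → X ⊆ D

  -- No edge of `X` leaves `D`, so both parts share one palette.
  colour-closed : ∀ {D X k} → Closed D X → ColourableOn D k → ColourableOn (X ∩ ∁ D) k → ColourableOn X k
  colour-closed {D} {X} {k} closed (c , c< , c-proper) (d , d< , d-proper) = e , bound , proper
    where
    e : V → ℕ
    e u with u ∈? D
    ... | yes _ = c u
    ... | no _ = d u
    bound : ∀ {u} → u ∈ X → e u < k
    bound {u} u∈X with u ∈? D
    ... | yes u∈D = c< u∈D
    ... | no u∉D = d< (∈∖⁺ u∈X u∉D)
    proper : ∀ {u v} → u ∈ X → v ∈ X → Adj G u v → e u ≢ e v
    proper {u} {v} u∈X v∈X a with u ∈? D | v ∈? D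
    ... | yes u∈D | yes v∈D = c-proper u∈D v∈D a
    ... | yes u∈D | no v∉D = contradiction (closed u v u∈D v∈X a) v∉D
    ... | no u∉D | yes v∈D = contradiction (closed v u v∈D u∈X (Adj-sym G a)) u∉D
    ... | no u∉D | no v∉D = d-proper (∈∖⁺ u∈X u∉D) (∈∖⁺ v∈X v∉D) a

  -- Components are never listed. A nonempty proper closed subset is split off and both halves
  -- follow by induction on cardinality; if there is none, the set is connected.
  colour-components : ∀ X k →
    (∀ D → D ⊆ X → Nonempty D → Closed D X → Connected D → ColourableOn D k) → ColourableOn X k
  colour-components X k = go X (<-wellFounded ∣ X ∣)
    where
    go : ∀ X → Acc _<_ ∣ X ∣ →
         (∀ D → D ⊆ X → Nonempty D → Closed D X → Connected D → ColourableOn D k) → ColourableOn X k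
    go X (acc rec) component with nonempty? X
    ... | no empty = (λ _ → 0) , (λ u∈ → contradiction (_ , u∈) empty) , λ u∈ → contradiction (_ , u∈) empty
    ... | yes ne with anySubset? (λ D → D ⊂? X ×-dec (nonempty? D ×-dec closed? D X))
    ... | no none = component X ⊆-refl ne (λ _ _ _ v∈ _ → v∈) connected
      where
      connected : Connected X
      connected D D⊆X neD closed {x} x∈X with x ∈? D
      ... | yes x∈D = x∈D
      ... | no x∉D = contradiction (D , ((λ {_} → D⊆X) , x , x∈X , x∉D) , neD , closed) none
    ... | yes (D , D⊂X , (d , d∈D) , closed) =
      colour-closed closed
        (go D (rec (p⊂q⇒∣p∣<∣q∣ D⊂X)) λ E E⊆D neE closedE →
          component E (D⊆X ∘ E⊆D) neE λ u v u∈E v∈X a → closedE u v u∈E (closed u v (E⊆D u∈E) v∈X a) a)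
        -- By symmetry of adjacency the rest of `X` is closed as well, so its closed subsets are
        -- closed in `X`.
        (go (X ∩ ∁ D) (rec (p⊂q⇒∣p∣<∣q∣ (p∩q⊆p X (∁ D) , d , D⊆X d∈D , λ d∈ → ∈∖⁻ {X} d∈ d∈D))) λ E E⊆ neE closedE →
          component E (p∩q⊆p X (∁ D) ∘ E⊆) neE λ u v u∈E v∈X a →
            closedE u v u∈E (∈∖⁺ v∈X λ v∈D → ∈∖⁻ {X} (E⊆ u∈E) (closed v u v∈D (p∩q⊆p X (∁ D) (E⊆ u∈E)) (Adj-sym G a))) a)
      where
      D⊆X : D ⊆ X
      D⊆X = proj₁ D⊂X

  -- Gyárfás's argument in P₅-free graphs.

  module _ (P5-free : Free P5 G) where

    -- `Adj` also fails on equal vertices, so non-adjacent pairs need distinctness separately.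
    no-induced-path : ∀ {a b c d e} →
      Adj G a b → Adj G b c → Adj G c d → Adj G d e →
      a ≢ c → ¬ Adj G a c → a ≢ d → ¬ Adj G a d → a ≢ e → ¬ Adj G a e →
      b ≢ d → ¬ Adj G b d → b ≢ e → ¬ Adj G b e → c ≢ e → ¬ Adj G c e → ⊥
    no-induced-path {a} {b} {c} {d} {e} ab bc cd de a≢c ac a≢d ad a≢e ae b≢d bd b≢e be c≢e ce =
      P5-free (↪-from-< P5 G f ordered)
      where
      f : Fin 5 → V
      f 0F = a
      f 1F = b
      f 2F = c
      f 3F = d
      f 4F = e
      joined : ∀ {i j} → i ≢ j → T (edge P5 i j ∨ edge P5 j i) → Adj G (f i) (f j) →
               f i ≢ f j × (Adj P5 i j ⇔ Adj G (f i) (f j))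
      joined i≢j e a~ = proj₁ a~ , mk⇔ (λ _ → a~) (λ _ → i≢j , e)
      apart : ∀ {i j} → ¬ T (edge P5 i j ∨ edge P5 j i) → f i ≢ f j → ¬ Adj G (f i) (f j) →
              f i ≢ f j × (Adj P5 i j ⇔ Adj G (f i) (f j))
      apart ¬e fi≢fj ¬a = fi≢fj , mk⇔ (λ (_ , e) → contradiction e ¬e) (λ a~ → contradiction a~ ¬a)
      ordered : ∀ i j → toℕ i < toℕ j → f i ≢ f j × (Adj P5 i j ⇔ Adj G (f i) (f j))
      ordered _ 0F ()
      ordered 0F 1F _ = joined (λ ()) tt ab
      ordered (fsuc _) 1F (s≤s ())
      ordered 0F 2F _ = apart (λ ()) a≢c ac
      ordered 1F 2F _ = joined (λ ()) tt bc
      ordered (fsuc (fsuc _)) 2F (s≤s (s≤s ()))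
      ordered 0F 3F _ = apart (λ ()) a≢d ad
      ordered 1F 3F _ = apart (λ ()) b≢d bd
      ordered 2F 3F _ = joined (λ ()) tt cd
      ordered (fsuc (fsuc (fsuc _))) 3F (s≤s (s≤s (s≤s ())))
      ordered 0F 4F _ = apart (λ ()) a≢e ae
      ordered 1F 4F _ = apart (λ ()) b≢e be
      ordered 2F 4F _ = apart (λ ()) c≢e ce
      ordered 3F 4F _ = joined (λ ()) tt de
      ordered 4F 4F (s≤s (s≤s (s≤s (s≤s ()))))

    colour-from-neighbourhoods : ∀ X p →
      (∀ v → v ∈ X → ColourableOn (X ∩ N v) p) → ColourableOn X (p + suc (p + p))
    colour-from-neighbourhoods X p local = colour-components X _ λ E E⊆X (v , v∈E) _ E-connected →
      let
        N-colour : ∀ {Y u} → u ∈ X → Y ⊆ X → ColourableOn (Y ∩ N u) p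
        N-colour u∈X Y⊆X = colour-mono (∩-mono _ Y⊆X) ≤-refl (local _ u∈X)
        R = (E ∩ ∁ (N v)) ∩ ∁ ⁅ v ⁆
      in
      colour-split (N v) (N-colour (E⊆X v∈E) E⊆X)
        (colour-split ⁅ v ⁆ (colour-mono (p∩q⊆q (E ∩ ∁ (N v)) ⁅ v ⁆) ≤-refl (colour-singleton v))
          (colour-components R _ λ C C⊆R C-nonempty C-closed C-connected →
            far-component E⊆X v∈E E-connected C⊆R C-nonempty C-closed C-connected))
      where
      far-component : ∀ {E v C} → E ⊆ X → v ∈ E → Connected E →
        let R = (E ∩ ∁ (N v)) ∩ ∁ ⁅ v ⁆ in
        C ⊆ R → Nonempty C → Closed C R → Connected C → ColourableOn C (p + p)
      far-component {E} {v} {C} E⊆X v∈E E-connected C⊆R C-nonempty C-closed C-connected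
        with any? (λ u → (u ∈? E ∩ N v) ×-dec any? (λ c → (c ∈? C) ×-dec Adj? G u c))
      -- With no edge from `E ∩ N v` to `C`, the set `C` would be closed in the connected `E` and so
      -- contain `v`.
      ... | no none = contradiction (x∈⁅x⁆ v) (∈∖⁻ {E ∩ ∁ (N v)} (C⊆R (E-connected C C⊆E C-nonempty closed v∈E)))
        where
        C⊆E : C ⊆ E
        C⊆E = p∩q⊆p E _ ∘ p∩q⊆p (E ∩ ∁ (N v)) _ ∘ C⊆R
        closed : Closed C E
        closed x y x∈C y∈E a with y ∈? N v
        ... | yes y∈N = contradiction (y , x∈p∩q⁺ (y∈E , y∈N) , x , x∈C , Adj-sym G a) none
        ... | no y∉N with y ≟F v
        ...   | yes refl = contradiction (∈N⁺ (Adj-sym G a)) (∈∖⁻ {E} (p∩q⊆p (E ∩ ∁ (N v)) _ (C⊆R x∈C)))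
        ...   | no y≢v = C-closed x y x∈C (∈∖⁺ (∈∖⁺ y∈E y∉N) (x≢y⇒x∉⁅y⁆ y≢v)) a
      ... | yes (u , u∈ , c , c∈C , uc) =
        colour-split (N u) (N-colour u∈X) (colour-components (C ∩ ∁ (N u)) p deep-component)
        where
        C⊆E : C ⊆ E
        C⊆E = p∩q⊆p E _ ∘ p∩q⊆p (E ∩ ∁ (N v)) _ ∘ C⊆R
        u∈X : u ∈ X
        u∈X = E⊆X (p∩q⊆p E (N v) u∈)
        vu : Adj G v u
        vu = ∈N⁻ (p∩q⊆q E (N v) u∈)
        N-colour : ∀ {w} → w ∈ X → ColourableOn (C ∩ N w) p
        N-colour w∈X = colour-mono (∩-mono _ (E⊆X ∘ C⊆E)) ≤-refl (local _ w∈X)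
        not-near-v : ∀ {x} → x ∈ C → ¬ Adj G v x
        not-near-v x∈C a = ∈∖⁻ {E} (p∩q⊆p (E ∩ ∁ (N v)) _ (C⊆R x∈C)) (∈N⁺ a)
        not-v : ∀ {x} → x ∈ C → v ≢ x
        not-v x∈C refl = ∈∖⁻ {E ∩ ∁ (N v)} (C⊆R x∈C) (x∈⁅x⁆ v)
        not-u : ∀ {x} → x ∈ C → u ≢ x
        not-u x∈C refl = not-near-v x∈C vu
        deep-component : ∀ D → D ⊆ C ∩ ∁ (N u) → Nonempty D → Closed D (C ∩ ∁ (N u)) → Connected D → ColourableOn D p
        deep-component D D⊆ D-nonempty D-closed D-connected
          with any? (λ c' → (c' ∈? C ∩ N u) ×-dec any? (λ d → (d ∈? D) ×-dec Adj? G c' d))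
        -- Otherwise `D` would be closed in the connected `C` and so contain `c`, a neighbour of
        -- `u`.
        ... | no none = contradiction (∈N⁺ uc) (∈∖⁻ {C} (D⊆ (C-connected D (p∩q⊆p C _ ∘ D⊆) D-nonempty closed c∈C)))
          where
          closed : Closed D C
          closed x y x∈D y∈C a with y ∈? N u
          ... | yes y∈N = contradiction (y , x∈p∩q⁺ (y∈C , y∈N) , x , x∈D , Adj-sym G a) none
          ... | no y∉N = D-closed x y x∈D (∈∖⁺ y∈C y∉N) a
        ... | yes (c' , c'∈ , d , d∈D , c'd) =
          colour-mono (λ x∈D → x∈p∩q⁺ (D⊆C x∈D , D⊆N x∈D)) ≤-refl (N-colour (E⊆X (C⊆E c'∈C)))
          where
          D⊆C : D ⊆ C
          D⊆C = p∩q⊆p C _ ∘ D⊆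
          c'∈C : c' ∈ C
          c'∈C = p∩q⊆p C (N u) c'∈
          uc' : Adj G u c'
          uc' = ∈N⁻ (p∩q⊆q C (N u) c'∈)
          not-near-u : ∀ {x} → x ∈ D → ¬ Adj G u x
          not-near-u x∈D a = ∈∖⁻ {C} (D⊆ x∈D) (∈N⁺ a)
          closed : Closed (D ∩ N c') D
          closed x y x∈ y∈D a with y ∈? N c'
          ... | yes y∈N = x∈p∩q⁺ (y∈D , y∈N)
          -- The induced path is `v`, `u`, `c'`, `x`, `y`; here `c' ≢ y` because `u` is adjacent to
          -- `c'` but to nothing in `D`.
          ... | no y∉N = ⊥-elim (no-induced-path vu uc' (∈N⁻ (p∩q⊆q D _ x∈)) a
              (not-v c'∈C) (not-near-v c'∈C) (not-v (D⊆C x∈D)) (not-near-v (D⊆C x∈D))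
              (not-v (D⊆C y∈D)) (not-near-v (D⊆C y∈D))
              (not-u (D⊆C x∈D)) (not-near-u x∈D) (not-u (D⊆C y∈D)) (not-near-u y∈D)
              (λ { refl → not-near-u y∈D uc' }) (y∉N ∘ ∈N⁺))
            where
            x∈D : x ∈ D
            x∈D = p∩q⊆p D _ x∈
          D⊆N : D ⊆ N c'
          D⊆N = p∩q⊆q D _ ∘ D-connected (D ∩ N c') (p∩q⊆p D _) (d , x∈p∩q⁺ (d∈D , ∈N⁺ c'd)) closed

  -- Cliques

  -- Choosing vertices one by one makes this decidable by search and lets inductions pass to a
  -- neighbourhood. Distinctness is automatic, as `v` is not in `N v`.
  Clique : ℕ → Subset (size G) → Set
  Clique zero X = Unit
  Clique (suc k) X = Σ V λ v → v ∈ X × Clique k (X ∩ N v)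

  clique? : ∀ k X → Dec (Clique k X)
  clique? zero X = yes tt
  clique? (suc k) X = any? λ v → (v ∈? X) ×-dec clique? k (X ∩ N v)

  clique-mono : ∀ k {X Y} → X ⊆ Y → Clique k X → Clique k Y
  clique-mono zero X⊆Y _ = tt
  clique-mono (suc k) X⊆Y (v , v∈ , K) = v , X⊆Y v∈ , clique-mono k (∩-mono (N v) X⊆Y) K

  -- Sizes are tried downwards from `w`; failure at one size is the maximality proof for the next.
  maximum-clique : ∀ w X → ¬ Clique (suc w) X → Σ ℕ λ z → z ≤ w × Clique z X × ¬ Clique (suc z) X
  maximum-clique zero X none = 0 , z≤n , tt , none
  maximum-clique (suc w) X none with clique? (suc w) X
  ... | yes K = suc w , ≤-refl , K , none
  ... | no none' with maximum-clique w X none'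
  ...   | z , z≤w , K , max = z , m≤n⇒m≤1+n z≤w , K , max

  -- K_i in Z together with K_t in Y, anticomplete to each other.
  CliquePair : ℕ → ℕ → Subset (size G) → Subset (size G) → Set
  CliquePair t zero Z Y = Clique t Y
  CliquePair t (suc i) Z Y = Σ V λ v → v ∈ Z × CliquePair t i (Z ∩ N v) (Y ∩ ∁ (N v))

  cliquePair-mono : ∀ t i {Z Z' Y Y'} → Z ⊆ Z' → Y ⊆ Y' → CliquePair t i Z Y → CliquePair t i Z' Y'
  cliquePair-mono t zero Z⊆ Y⊆ = clique-mono t Y⊆
  cliquePair-mono t (suc i) Z⊆ Y⊆ (v , v∈ , P) =
    v , Z⊆ v∈ , cliquePair-mono t i (∩-mono (N v) Z⊆) (∩-mono (∁ (N v)) Y⊆) P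

  CliqueMap : ℕ → Subset (size G) → Set
  CliqueMap k X = Σ (Fin k → V) λ f → (∀ i → f i ∈ X) × (∀ i j → i ≢ j → Adj G (f i) (f j))

  cons-map : ∀ {k X} v → v ∈ X → CliqueMap k (X ∩ N v) → CliqueMap (suc k) X
  cons-map {k} {X} v v∈X (f , f∈ , adj) = g , g∈ , g-adj
    where
    g : Fin (suc k) → V
    g fzero = v
    g (fsuc i) = f i
    g∈ : ∀ i → g i ∈ X
    g∈ fzero = v∈X
    g∈ (fsuc i) = p∩q⊆p X (N v) (f∈ i)
    g-adj : ∀ i j → i ≢ j → Adj G (g i) (g j)
    g-adj fzero fzero i≢j = contradiction refl i≢j
    g-adj fzero (fsuc j) _ = ∈N⁻ (p∩q⊆q X (N v) (f∈ j))
    g-adj (fsuc i) fzero _ = Adj-sym G (∈N⁻ (p∩q⊆q X (N v) (f∈ i)))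
    g-adj (fsuc i) (fsuc j) i≢j = adj i j (i≢j ∘ cong fsuc)

  clique-map : ∀ k {X} → Clique k X → CliqueMap k X
  clique-map zero _ = (λ ()) , (λ ()) , λ ()
  clique-map (suc k) (v , v∈ , K) = cons-map v v∈ (clique-map k K)

  cliquePair-maps : ∀ t i {Z Y} → CliquePair t i Z Y →
    Σ (CliqueMap i Z) λ K → Σ (CliqueMap t Y) λ L → ∀ a b → ¬ Adj G (proj₁ K a) (proj₁ L b)
  cliquePair-maps t zero K = ((λ ()) , (λ ()) , λ ()) , clique-map t K , λ ()
  cliquePair-maps t (suc i) {Z} {Y} (v , v∈ , P) with cliquePair-maps t i P
  ... | K , L@(g , g∈ , g-adj) , anti =
    cons-map v v∈ K , (g , (λ b → p∩q⊆p Y _ (g∈ b)) , g-adj) ,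
    λ { fzero b a → ∈∖⁻ {Y} (g∈ b) (∈N⁺ a) ; (fsuc a) b → anti a b }

  clique→HasClique : ∀ {k X} → Clique k X → HasClique G k
  clique→HasClique {k} K with clique-map k K
  ... | f , _ , adj = f , injective , adj
    where
    injective : ∀ {i j} → f i ≡ f j → i ≡ j
    injective {i} {j} eq with i ≟F j
    ... | yes i≡j = i≡j
    ... | no i≢j = contradiction eq (proj₁ (adj i j i≢j))

  cliquePair→bowtie : ∀ {s t} x → 2 ≤ s → CliquePair t s (N x) (N x) → bowtie s t ↪ G
  cliquePair→bowtie {s} {t} x 2≤s P with cliquePair-maps t s P
  ... | (f , f∈ , f-adj) , (g , g∈ , g-adj) , anti = h , injective , adj
    where
    fg : Fin s ⊎ Fin t → V
    fg = [ f , g ]′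
    another : ∀ {s} → 2 ≤ s → (a : Fin s) → Σ (Fin s) (_≢ a)
    another (s≤s (s≤s _)) fzero = fsuc fzero , λ ()
    another (s≤s (s≤s _)) (fsuc _) = fzero , λ ()
    -- `Y ∩ ∁ (N v)` may still contain `v`, so the cliques could share a vertex. A second vertex of
    -- the first clique, available as 2 ≤ s, would be adjacent to it, against `anti`.
    f≢g : ∀ a b → f a ≢ g b
    f≢g a b eq with another 2≤s a
    ... | a' , a'≢a = anti a' b (subst (Adj G (f a')) eq (f-adj a' a a'≢a))
    x~ : ∀ p → Adj G x (fg p)
    x~ (inj₁ a) = ∈N⁻ (f∈ a)
    x~ (inj₂ b) = ∈N⁻ (g∈ b)
    fg-injective : ∀ p q → fg p ≡ fg q → p ≡ q
    fg-injective (inj₁ a) (inj₁ b) eq with a ≟F b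
    ... | yes a≡b = cong inj₁ a≡b
    ... | no a≢b = contradiction eq (proj₁ (f-adj a b a≢b))
    fg-injective (inj₁ a) (inj₂ b) eq = contradiction eq (f≢g a b)
    fg-injective (inj₂ a) (inj₁ b) eq = contradiction (sym eq) (f≢g b a)
    fg-injective (inj₂ a) (inj₂ b) eq with a ≟F b
    ... | yes a≡b = cong inj₂ a≡b
    ... | no a≢b = contradiction eq (proj₁ (g-adj a b a≢b))
    fg-adj : ∀ p q → SameSide p q ⇔ Adj G (fg p) (fg q)
    fg-adj (inj₁ a) (inj₁ b) = mk⇔ (f-adj a b) λ e a≡b → proj₁ e (cong f a≡b)
    fg-adj (inj₁ a) (inj₂ b) = mk⇔ ⊥-elim λ e → anti a b e
    fg-adj (inj₂ a) (inj₁ b) = mk⇔ ⊥-elim λ e → anti b a (Adj-sym G e)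
    fg-adj (inj₂ a) (inj₂ b) = mk⇔ (g-adj a b) λ e a≡b → proj₁ e (cong g a≡b)
    h : Fin (suc (s + t)) → V
    h fzero = x
    h (fsuc i) = fg (splitAt s i)
    injective : ∀ {i j} → h i ≡ h j → i ≡ j
    injective {fzero} {fzero} _ = refl
    injective {fzero} {fsuc j} eq = contradiction eq (proj₁ (x~ (splitAt s j)))
    injective {fsuc i} {fzero} eq = contradiction (sym eq) (proj₁ (x~ (splitAt s i)))
    injective {fsuc i} {fsuc j} eq = cong fsuc (splitAt-injective (fg-injective _ _ eq))
      where
      splitAt-injective : splitAt s i ≡ splitAt s j → i ≡ j
      splitAt-injective e = trans (sym (join-splitAt s t i)) (trans (cong (join s t) e) (join-splitAt s t j))
    adj : ∀ i j → Adj (bowtie s t) i j ⇔ Adj G (h i) (h j)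
    adj fzero fzero = mk⇔ (λ a → contradiction refl (proj₁ a)) (λ a → contradiction refl (proj₁ a))
    adj fzero (fsuc j) = mk⇔ (λ _ → x~ (splitAt s j)) (λ _ → (λ ()) , tt)
    adj (fsuc i) fzero = mk⇔ (λ _ → Adj-sym G (x~ (splitAt s i))) (λ _ → (λ ()) , tt)
    adj (fsuc i) (fsuc j) = ⇔-trans (bowtie-adj i j) (fg-adj (splitAt s i) (splitAt s j))

  -- P₅-free sets without a clique pair.

  module _ (P5-free : Free P5 G) where

    -- Adding `v` enlarges any clique in `X ∩ N v`, so the induction hypothesis colours every
    -- neighbourhood within `X`.
    gyarfas : ∀ k {X} → ¬ Clique k X → ColourableOn X (gyarfasBound k)
    gyarfas zero none = contradiction tt none
    gyarfas (suc k) {X} none = colour-from-neighbourhoods P5-free X _ λ v v∈ →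
      gyarfas k λ K → none (v , v∈ , K)

    -- U consists of common neighbours of the clique vertices kept so far. Z holds the rest of
    -- the maximum clique, and r of its vertices have been spent as non-neighbours of Y.
    colour-no-cliquePair : ∀ t M i r z {U Z Y} → gyarfasBound t ≤ M → gyarfasBound (suc (i + r)) ≤ M →
      Z ⊆ U → Y ⊆ U → Clique z Z → ¬ Clique (suc (z + r)) U → ¬ CliquePair t i Z Y →
      ColourableOn Y (M * suc z ^ i)
    -- The first clique of the pair is complete, so `noPair` says that `Y` has no `t`-clique.
    colour-no-cliquePair t M zero r z t≤M _ _ _ _ _ noPair =
      colour-mono ⊆-refl (≤-trans t≤M (≤-reflexive (sym (*-identityʳ M)))) (gyarfas t noPair)
    -- The maximum clique is exhausted, so `small` bounds cliques in `U`, hence in `Y`, by `r`. The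
    -- sum of the budget and `r` never changes, so one bound on `M` serves every `r`.
    colour-no-cliquePair t M (suc i) r zero _ r≤M _ Y⊆U _ small _ =
      colour-mono Y⊆U (≤-trans (gyarfasBound-mono (suc i) (suc r)) (≤-trans (≤-reflexive (cong (gyarfasBound ∘ suc) (+-suc i r)))
        (≤-trans r≤M (≤-reflexive (trans (sym (*-identityʳ M)) (cong (M *_) (sym (^-zeroˡ (suc i)))))))))
        (gyarfas (suc r) small)
    colour-no-cliquePair t M (suc i) r (suc z) {U} {Z} {Y} t≤M r≤M Z⊆U Y⊆U (v , v∈Z , K) small noPair =
      colour-mono ⊆-refl count
        (colour-split (N v)
          -- Every clique in the new `U` extends by `v`, so the clique bound drops along with the
          -- remaining clique.
          (colour-no-cliquePair t M (suc i) r z t≤M r≤M (∩-mono (N v) Z⊆U) (∩-mono (N v) Y⊆U) K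
            (λ L → small (v , Z⊆U v∈Z , L))
            (noPair ∘ cliquePair-mono t (suc i) (p∩q⊆p Z (N v)) (p∩q⊆p Y (N v))))
          -- `U` is kept: `v` enters the pair and is counted in `r` instead of `z`, preserving the
          -- clique bound.
          (colour-no-cliquePair t M i (suc r) z t≤M
            (subst (λ n → gyarfasBound (suc n) ≤ M) (sym (+-suc i r)) r≤M)
            (Z⊆U ∘ p∩q⊆p Z (N v)) (Y⊆U ∘ p∩q⊆p Y (∁ (N v))) K
            (subst (λ n → ¬ Clique (suc n) U) (sym (+-suc z r)) small)
            (λ P → noPair (v , v∈Z , P))))
      where
      open ≤-Reasoning
      -- A Pascal-type recursion: (z+1)^(i+1) + (z+1)^i = (z+2)(z+1)^i, which is at most
      -- (z+2)^(i+1).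
      count : M * suc z ^ suc i + M * suc z ^ i ≤ M * suc (suc z) ^ suc i
      count = begin
        M * suc z ^ suc i + M * suc z ^ i   ≡⟨ *-distribˡ-+ M (suc z ^ suc i) _ ⟨
        M * (suc z ^ suc i + suc z ^ i)     ≡⟨ cong (M *_) (+-comm (suc z ^ suc i) _) ⟩
        M * (suc (suc z) * suc z ^ i)       ≤⟨ *-monoʳ-≤ M (*-monoʳ-≤ (suc (suc z)) (^-monoˡ-≤ i (n≤1+n (suc z)))) ⟩
        M * suc (suc z) ^ suc i             ∎

  colourable : ∀ {k} → ColourableOn Full k → Colourable G k
  colourable (c , bound , proper) =
    (λ u → fromℕ< (bound (∈⊤ {x = u}))) ,
    λ u v a eq → proper ∈⊤ ∈⊤ a (fromℕ<-injective _ _ (bound ∈⊤) (bound ∈⊤) eq)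

-- Coefficient lists of polynomials.

addPoly : List ℕ → List ℕ → List ℕ
addPoly [] q = q
addPoly (a ∷ p) [] = a ∷ p
addPoly (a ∷ p) (b ∷ q) = a + b ∷ addPoly p q

evalPoly-addPoly : ∀ p q x → evalPoly (addPoly p q) x ≡ evalPoly p x + evalPoly q x
evalPoly-addPoly [] q x = refl
evalPoly-addPoly (a ∷ p) [] x = sym (+-identityʳ _)
evalPoly-addPoly (a ∷ p) (b ∷ q) x rewrite evalPoly-addPoly p q x = rearrange a b x (evalPoly p x) (evalPoly q x)
  where
  rearrange : ∀ a b x y z → a + b + x * (y + z) ≡ a + x * y + (b + x * z)
  rearrange = solve-∀

-- The coefficients of m(x+1)^s: prepending 0 multiplies by x, and adding the unshifted list gives
-- the factor x+1.
shiftedPower : ℕ → ℕ → List ℕ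
shiftedPower m zero = m ∷ []
shiftedPower m (suc s) = addPoly (shiftedPower m s) (0 ∷ shiftedPower m s)

evalPoly-shiftedPower : ∀ m s x → evalPoly (shiftedPower m s) x ≡ m * suc x ^ s
evalPoly-shiftedPower m zero x = constant m x
  where
  constant : ∀ m x → m + x * 0 ≡ m * 1
  constant = solve-∀
evalPoly-shiftedPower m (suc s) x
  rewrite evalPoly-addPoly (shiftedPower m s) (0 ∷ shiftedPower m s) x | evalPoly-shiftedPower m s x
  = factor m x (suc x ^ s)
  where
  factor : ∀ m x y → m * y + x * (m * y) ≡ m * (y + x * y)
  factor = solve-∀

theorem2p8 : ∀ (s t : ℕ) → 2 ≤ s → 2 ≤ t →
    StronglyPollyanna (2 * t ∸ 2)
    (λ G → Free (bowtie s t) G × Free P5 G × Free (dumbbell (s + 1) (t + 1)) G)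
theorem2p8 s t 2≤s 2≤t F F-good = poly , bounded
  where
  -- The sum dominates the bounds for both kinds of final part: no `t`-clique, or clique number at
  -- most `s`. The term `s + 0` is `i + r` at the start.
  M : ℕ
  M = gyarfasBound t + gyarfasBound (suc (s + 0))
  local : List ℕ
  local = shiftedPower M s
  poly : List ℕ
  -- This mirrors `p + suc (p + p)` with `p = M * suc w ^ s`.
  poly = addPoly local (addPoly (1 ∷ []) (addPoly local local))
  poly-value : ∀ w → let B = M * suc w ^ s in evalPoly poly w ≡ B + suc (B + B)
  poly-value w
    rewrite evalPoly-addPoly local (addPoly (1 ∷ []) (addPoly local local)) w
          | evalPoly-addPoly (1 ∷ []) (addPoly local local) w
          | evalPoly-addPoly local local w
          | evalPoly-shiftedPower M s w
    = constant (M * suc w ^ s) w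
    where
    constant : ∀ b w → b + (1 + w * 0 + (b + b)) ≡ b + suc (b + b)
    constant = solve-∀
  bounded : ∀ G → ((Free (bowtie s t) G × Free P5 G × Free (dumbbell (s + 1) (t + 1)) G) × F G) →
            ∀ w → CliqueNumber G w → Colourable G (evalPoly poly w)
  bounded G ((bowtie-free , P5-free , _) , _) w (_ , ω≤w) =
    subst (Colourable G) (sym (poly-value w))
      (colourable G (colour-from-neighbourhoods G P5-free Full _ λ x _ → neighbourhood x))
    where
    neighbourhood : ∀ x → ColourableOn G (Full ∩ N G x) (M * suc w ^ s)
    neighbourhood x with maximum-clique G w (Full ∩ N G x) (ω≤w ∘ clique→HasClique G)
    ... | z , z≤w , K , max =
      colour-mono G ⊆-refl (*-monoʳ-≤ M (^-monoˡ-≤ s (s≤s z≤w)))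
        -- `U`, `Z` and `Y` all start as the neighbourhood of `x`, with nothing spent; a pair found
        -- there forms a bowtie centred at `x`.
        (colour-no-cliquePair G P5-free t M s 0 z (m≤m+n _ _) (m≤n+m _ (gyarfasBound t)) ⊆-refl ⊆-refl K
          (subst (λ n → ¬ Clique G (suc n) (Full ∩ N G x)) (sym (+-identityʳ z)) max)
          (bowtie-free ∘ cliquePair→bowtie G x 2≤s
            ∘ cliquePair-mono G t s (p∩q⊆q Full (N G x)) (p∩q⊆q Full (N G x))))
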